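{- Let $p$ be a prime, and let $A$ and $B$ be non-empty subsets of $\mathbb{Z}_p$ with $|B| \leq |A| \leq 2^{ -20}p$ and $B$ an interval. Then there exist elements $b_1,b_2,b_3 \in B$ such that $$|A+\{b_1, b_2,b_3\}| \ge |A|+|B|-1.$$
   Context: $\mathbb{Z}_p$ is the cyclic group of prime order $p$. An interval in $\mathbb{Z}_p$ is a set of the form $[x,y]=\{x,x+1,\dots,y\}$, i.e. a set of consecutive residues. For subsets $X,Y$ of an abelian group, $X+Y=\{x+y : x\in X, y\in Y\}$. The elements $b_1,b_2,b_3$ are not required to be distinct. -}

module Defs where

open import Data.Fin using (Fin; toℕ)
open import Data.Fin.Properties using (_≟_; any?; nonZeroIndex)
open import Data.Fin.Subset using (Subset)
open import Data.Fin.Subset.Properties using (_∈?_)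
open import Data.Nat using (_+_; _∸_; _≤?_)
open import Data.Nat.DivMod using (_mod_)
open import Data.Product using (∃₂)
open import Data.Vec using (tabulate)
open import Relation.Binary.PropositionalEquality using (_≡_)
open import Relation.Nullary using (does)
open import Relation.Nullary.Decidable using (_×-dec_)

-- The cyclic group ℤ/n has carrier Fin n, with arithmetic modulo n.

infixl 6 _⊕_ _⊖_

_⊕_ : ∀ {n} → Fin n → Fin n → Fin n
_⊕_ {n} x y = ((toℕ x + toℕ y) mod n) {{nonZeroIndex x}}

_⊖_ : ∀ {n} → Fin n → Fin n → Fin n
_⊖_ {n} x y = ((toℕ x + (n ∸ toℕ y)) mod n) {{nonZeroIndex x}}

infixl 6 _⊞_

_⊞_ : ∀ {n} → Subset n → Subset n → Subset n
X ⊞ Y = tabulate λ z →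
  does (any? λ x → any? λ y → (x ∈? X) ×-dec ((y ∈? Y) ×-dec (z ≟ x ⊕ y)))

-- {x, x+1, …, y}: the residues z met on the way from x up (cyclically) to the
-- first occurrence of y.  It is never empty, and is all of ℤ/n when y = x - 1.
[_⋯_] : ∀ {n} → Fin n → Fin n → Subset n
[ x ⋯ y ] = tabulate λ z → does (toℕ (z ⊖ x) ≤? toℕ (y ⊖ x))

IsInterval : ∀ {n} → Subset n → Set
IsInterval B = ∃₂ λ x y → B ≡ [ x ⋯ y ]

{-# OPTIONS --safe #-}

-- Identify A with a p-periodic set of integers, write |B| = m + 1, let N = |A|, and let w n be
-- the number of elements of A in [n, n + m).  If c is any set, then averaging over a translate
-- A - j with 0 ≤ j < m shows that some j adds at least N - (Σ_{n ∈ c} w n) / m new points to c.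
--
-- If w ≤ m/3 everywhere, two such greedy steps starting from c = A reach 2N ≥ N + m points.
--
-- Otherwise take c = A ∪ (A - m) and let r = |c| - N.  It suffices that Σ_{n ∈ c} w n ≤ N r:
-- then at least N (m - r) / m ≥ m - r points are new.  From n to n + 1, w goes up by 1 if n lies
-- in A - m only, down by 1 if n lies in A only, and each happens r times per period.  Cut the
-- circle at a minimum w₀ of w and let M be the maximum; telescoping w² evaluates the sum of w
-- over all moves.  For w₀ = 0 the bound follows from M ≤ r; in general there is an error of
-- O(w₀ N).  It is compensated by the windows of length m on which w is small, of which there
-- are many since p ≥ 13 N: before the maximum such a window contains at least w₀ points of A,
-- after it at least w₀ points of A - m, and at each of these points n, where w stays or moves
-- against the overall trend, the bound gains about M - w n.
module Submission where

open import Defs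
open import Data.Bool using (Bool; true; false; not; _∧_; _∨_)
open import Data.Fin using (Fin; toℕ)
open import Data.Fin.Properties using (toℕ-injective; toℕ-fromℕ<; toℕ<n; any?; _≟_)
open import Data.Fin.Subset using (Subset; Nonempty; ∣_∣; _∈_; _∪_; ⁅_⁆)
open import Data.Fin.Subset.Properties using (_∈?_; x∈⁅x⁆; x∈p∪q⁺)
open import Data.List using (upTo)
open import Data.List.Extrema.Nat
  using (argmin; argmax; argmin-all; argmax-all; f[argmin]≤f[xs]; f[xs]≤f[argmax])
open import Data.List.Membership.Propositional.Properties using (∈-upTo⁺)
import Data.List.Relation.Unary.All as All
open import Data.List.Relation.Unary.All.Properties using (all-upTo)
open import Data.Nat
  using (ℕ; NonZero; zero; suc; _+_; _*_; _∸_; _^_; _≤_; _≥_; _<_; z≤n; z<s)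
open import Data.Nat.DivMod
  using (_%_; _/_; _mod_; m≡m%n+[m/n]*n; m%n<n; m<n⇒m%n≡m; [m+n]%n≡m%n)
open import Data.Nat.Primality using (Prime)
open import Data.Nat.Properties hiding (_≟_)
open import Data.Nat.Tactic.RingSolver using (solve-∀)
open import Data.Product using (∃-syntax; _×_; _,_; proj₁; proj₂)
open import Data.Sum using (_⊎_; inj₁; inj₂)
open import Data.Unit using (tt)
open import Data.Vec using ([]; _∷_; lookup)
open import Data.Vec.Properties using (lookup∘tabulate; lookup⇒[]=; []=⇒lookup)
open import Function using (_∘_)
open import Relation.Binary.PropositionalEquality
  using (_≡_; refl; sym; trans; cong; cong₂; subst; module ≡-Reasoning)
open import Relation.Nullary using (Dec; does)
open import Relation.Nullary.Decidable using (dec-true; dec-false; _×-dec_)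

-- Finite sums and periodic functions

∑ : ℕ → (ℕ → ℕ) → ℕ
∑ zero    f = 0
∑ (suc n) f = ∑ n f + f n

∑-syntax : ℕ → (ℕ → ℕ) → ℕ
∑-syntax = ∑

infixr 8 ∑-syntax
syntax ∑-syntax n (λ i → e) = ∑[ i < n ] e

∑-mono : ∀ n {f g} → (∀ i → i < n → f i ≤ g i) → ∑ n f ≤ ∑ n g
∑-mono zero    h = z≤n
∑-mono (suc n) h = +-mono-≤ (∑-mono n (λ i i<n → h i (m<n⇒m<1+n i<n))) (h n ≤-refl)

∑-cong : ∀ n {f g} → (∀ i → i < n → f i ≡ g i) → ∑ n f ≡ ∑ n g
∑-cong zero    h = refl
∑-cong (suc n) h = cong₂ _+_ (∑-cong n (λ i i<n → h i (m<n⇒m<1+n i<n))) (h n ≤-refl)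

∑-≗ : ∀ n {f g} → (∀ i → f i ≡ g i) → ∑ n f ≡ ∑ n g
∑-≗ n h = ∑-cong n (λ i _ → h i)

∑-+ : ∀ n f g → ∑[ i < n ] (f i + g i) ≡ ∑ n f + ∑ n g
∑-+ zero    f g = refl
∑-+ (suc n) f g rewrite ∑-+ n f g = lemma (∑ n f) (∑ n g) (f n) (g n)
  where
  lemma : ∀ a b c d → a + b + (c + d) ≡ a + c + (b + d)
  lemma = solve-∀

∑-*ˡ : ∀ n k f → ∑[ i < n ] (k * f i) ≡ k * ∑ n f
∑-*ˡ zero    k f = sym (*-zeroʳ k)
∑-*ˡ (suc n) k f rewrite ∑-*ˡ n k f = sym (*-distribˡ-+ k (∑ n f) (f n))

∑-const : ∀ n k → ∑[ i < n ] k ≡ n * k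
∑-const zero    k = refl
∑-const (suc n) k rewrite ∑-const n k = +-comm (n * k) k

∑-split : ∀ m n f → ∑ (m + n) f ≡ ∑ m f + ∑[ i < n ] f (m + i)
∑-split m zero    f rewrite +-identityʳ m = sym (+-identityʳ _)
∑-split m (suc n) f rewrite +-suc m n | ∑-split m n f = +-assoc (∑ m f) _ _

∑-monoˡ : ∀ {m n} f → m ≤ n → ∑ m f ≤ ∑ n f
∑-monoˡ {m} {n} f m≤n = begin
  ∑ m f                                  ≤⟨ m≤m+n _ _ ⟩
  ∑ m f + ∑[ i < n ∸ m ] f (m + i)       ≡⟨ ∑-split m (n ∸ m) f ⟨
  ∑ (m + (n ∸ m)) f                      ≡⟨ cong (λ k → ∑ k f) (m+[n∸m]≡n m≤n) ⟩
  ∑ n f                                  ∎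
  where open ≤-Reasoning

∑-swap : ∀ m n (f : ℕ → ℕ → ℕ) →
  ∑[ i < m ] (∑[ j < n ] f i j) ≡ ∑[ j < n ] (∑[ i < m ] f i j)
∑-swap zero    n f = sym (trans (∑-const n 0) (*-zeroʳ n))
∑-swap (suc m) n f rewrite ∑-swap m n f = sym (∑-+ n (λ j → ∑[ i < m ] f i j) (f m))

-- Telescoping of `f (suc n) - f n = h n - g n`, with the negative terms moved across the equation
-- to stay in ℕ.
∑-telescope : ∀ (f g h : ℕ → ℕ) → (∀ n → f (suc n) + g n ≡ f n + h n) →
  ∀ k l → f (k + l) + ∑[ i < l ] g (k + i) ≡ f k + ∑[ i < l ] h (k + i)
∑-telescope f g h step k zero rewrite +-identityʳ k = refl
∑-telescope f g h step k (suc l) rewrite +-suc k l = begin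
  f (suc (k + l)) + (G + g (k + l))  ≡⟨ lemma (f (suc (k + l))) G (g (k + l)) ⟩
  f (suc (k + l)) + g (k + l) + G    ≡⟨ cong (_+ G) (step (k + l)) ⟩
  f (k + l) + h (k + l) + G          ≡⟨ lemma₂ (f (k + l)) (h (k + l)) G ⟩
  f (k + l) + G + h (k + l)          ≡⟨ cong (_+ h (k + l)) (∑-telescope f g h step k l) ⟩
  f k + H + h (k + l)                ≡⟨ +-assoc (f k) H _ ⟩
  f k + (H + h (k + l))              ∎
  where
  open ≡-Reasoning
  G = ∑[ i < l ] g (k + i)
  H = ∑[ i < l ] h (k + i)
  lemma : ∀ a b c → a + (b + c) ≡ a + c + b
  lemma = solve-∀
  lemma₂ : ∀ a b c → a + b + c ≡ a + c + b
  lemma₂ = solve-∀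

Periodic : ∀ {X : Set} → ℕ → (ℕ → X) → Set
Periodic p f = ∀ n → f (p + n) ≡ f n

periodic-shift : ∀ {X : Set} {p} {f : ℕ → X} → Periodic p f → ∀ k → Periodic p (λ n → f (k + n))
periodic-shift {p = p} {f} per k n =
  trans (cong f (lemma k p n)) (per (k + n))
  where
  lemma : ∀ k p n → k + (p + n) ≡ p + (k + n)
  lemma = solve-∀

∑-periodic : ∀ {p f} → Periodic p f → ∀ k → ∑[ i < p ] f (k + i) ≡ ∑ p f
∑-periodic {p} {f} per k = +-cancelˡ-≡ (∑ k f) _ _ (begin
  ∑ k f + ∑[ i < p ] f (k + i)  ≡⟨ ∑-split k p f ⟨
  ∑ (k + p) f                   ≡⟨ cong (λ n → ∑ n f) (+-comm k p) ⟩
  ∑ (p + k) f                   ≡⟨ ∑-split p k f ⟩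
  ∑ p f + ∑[ i < k ] f (p + i)  ≡⟨ cong (∑ p f +_) (∑-≗ k per) ⟩
  ∑ p f + ∑ k f                 ≡⟨ +-comm (∑ p f) _ ⟩
  ∑ k f + ∑ p f                 ∎)
  where open ≡-Reasoning

∑-periodicʳ : ∀ {p f} → Periodic p f → ∀ k → ∑[ i < p ] f (i + k) ≡ ∑ p f
∑-periodicʳ {p} {f} per k =
  trans (∑-≗ p (λ i → cong f (+-comm i k))) (∑-periodic per k)

∃-max : ∀ n .{{_ : NonZero n}} (f : ℕ → ℕ) → ∃[ t ] t < n × (∀ i → i < n → f i ≤ f t)
∃-max n@(suc _) f =
  argmax f 0 (upTo n) , argmax-all f z<s (all-upTo n) ,
  λ i i<n → All.lookup (f[xs]≤f[argmax] {f = f} 0 (upTo n)) (∈-upTo⁺ i<n)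

∃-min : ∀ n .{{_ : NonZero n}} (f : ℕ → ℕ) → ∃[ t ] t < n × (∀ i → i < n → f t ≤ f i)
∃-min n@(suc _) f =
  argmin f 0 (upTo n) , argmin-all f z<s (all-upTo n) ,
  λ i i<n → All.lookup (f[argmin]≤f[xs] {f = f} 0 (upTo n)) (∈-upTo⁺ i<n)

-- The maximum of `f` is at least its average.
pigeonhole : ∀ n .{{_ : NonZero n}} f → ∃[ j ] j < n × ∑ n f ≤ n * f j
pigeonhole n f with ∃-max n f
... | t , t<n , max = t , t<n , ≤-trans (∑-mono n max) (≤-reflexive (∑-const n (f t)))

periodic-% : ∀ {X : Set} {p} .{{_ : NonZero p}} {f : ℕ → X} → Periodic p f → ∀ n → f (n % p) ≡ f n
periodic-% {p = p} {f} per n = sym (trans (cong f (m≡m%n+[m/n]*n n p)) (strip (n / p) (n % p)))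
  where
  strip : ∀ k r → f (r + k * p) ≡ f r
  strip zero    r = cong f (+-identityʳ r)
  strip (suc k) r = trans (cong f (lemma r p (k * p))) (trans (per (r + k * p)) (strip k r))
    where
    lemma : ∀ r p x → r + (p + x) ≡ p + (r + x)
    lemma = solve-∀

-- Translates of a periodic set

⟦_⟧ : Bool → ℕ
⟦ true ⟧  = 1
⟦ false ⟧ = 0

⟦⟧≤1 : ∀ b → ⟦ b ⟧ ≤ 1
⟦⟧≤1 true  = ≤-refl
⟦⟧≤1 false = z≤n

∑-∨ : ∀ n (f g : ℕ → Bool) →
  ∑[ i < n ] ⟦ f i ∨ g i ⟧ ≡ ∑[ i < n ] ⟦ f i ⟧ + ∑[ i < n ] ⟦ not (f i) ∧ g i ⟧
∑-∨ n f g = trans (∑-≗ n (λ i → lemma (f i) (g i))) (∑-+ n _ _)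
  where
  lemma : ∀ x y → ⟦ x ∨ y ⟧ ≡ ⟦ x ⟧ + ⟦ not x ∧ y ⟧
  lemma true  y = refl
  lemma false y = refl

-- The hypothesis forces y = x + 1 if only `c` holds, y = x - 1 if only `b` holds, and y = x
-- otherwise. The conclusion is then (x ± 1)² = x² ± 2x + 1 without subtraction.
step-square : ∀ b c x y → y + ⟦ b ∧ not c ⟧ ≡ x + ⟦ not b ∧ c ⟧ →
  y * y + 2 * (x * ⟦ b ∧ not c ⟧) ≡
  x * x + (2 * (x * ⟦ not b ∧ c ⟧) + (⟦ not b ∧ c ⟧ + ⟦ b ∧ not c ⟧))
step-square true true x y eq
  rewrite +-cancelʳ-≡ 0 y x eq | *-zeroʳ x = refl
step-square false false x y eq
  rewrite +-cancelʳ-≡ 0 y x eq | *-zeroʳ x = refl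
step-square true false x y eq
  rewrite sym (trans eq (+-identityʳ x)) = lemma y
  where
  lemma : ∀ y → y * y + 2 * ((y + 1) * 1) ≡ (y + 1) * (y + 1) + (2 * ((y + 1) * 0) + 1)
  lemma = solve-∀
step-square false true x y eq
  rewrite trans (sym (+-identityʳ y)) eq = lemma x
  where
  lemma : ∀ x → (x + 1) * (x + 1) + 2 * (x * 0) ≡ x * x + (2 * (x * 1) + 1)
  lemma = solve-∀

-- Q, D, U count the n in A ∩ (A - m), in A only, in A - m only, and WQ, WD, WU are the same
-- sums weighted by w; the indices 1 and 2 refer to the stretches before and after the maximum.
excursion-arith : ∀ {M w₀ e} N Q WQ D₁ WD₁ U₁ WU₁ D₂ WD₂ U₂ WU₂ →
  w₀ + e ≡ M →
  M + D₁ ≡ w₀ + U₁ →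
  M * M + 2 * WD₁ ≡ w₀ * w₀ + (2 * WU₁ + (U₁ + D₁)) →
  w₀ + D₂ ≡ M + U₂ →
  w₀ * w₀ + 2 * WD₂ ≡ M * M + (2 * WU₂ + (U₂ + D₂)) →
  N ≡ Q + (U₁ + U₂) →
  M + w₀ ≤ N →
  WD₁ ≤ M * D₁ →
  WU₂ + U₂ ≤ M * U₂ →
  WQ + (WD₁ + WU₂) + w₀ * (2 * M + N) ≤ M * (Q + (D₁ + U₂)) →
  WQ + (WU₁ + WD₁ + (WU₂ + WD₂)) ≤ N * (U₁ + U₂)
excursion-arith {_} {w₀} {e} N Q WQ D WD₁ U₁ WU₁ D₂ WD₂ U WU₂
  refl drift₁ energy₁ drift₂ energy₂ N≡ M+w₀≤N WD₁≤ WU₂≤ deficit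
  -- The drifts fix the number of moves along the trend: U₁ = e + D₁ on the way up to the maximum
  -- and D₂ = e + U₂ on the way down.
  with +-cancelˡ-≡ w₀ (e + D) U₁ (trans (sym (+-assoc w₀ e D)) drift₁)
     | +-cancelˡ-≡ w₀ D₂ (e + U) (trans drift₂ (+-assoc w₀ e U))
... | refl | refl =
  +-cancelʳ-≤ (w₀ * w₀ + D + w₀ * (2 * M + N)) S (N * r) (begin
    S + (w₀ * w₀ + D + w₀ * (2 * M + N))           ≡⟨ +-assoc S _ _ ⟨
    S + (w₀ * w₀ + D) + w₀ * (2 * M + N)           ≡⟨ cong (_+ w₀ * (2 * M + N)) S≡ ⟩
    T + WD₁ + (WU₂ + U) + M * M + w₀ * (2 * M + N) ≡⟨ reorder T WD₁ (WU₂ + U) (M * M) _ ⟩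
    T + w₀ * (2 * M + N) + WD₁ + (WU₂ + U) + M * M
      ≤⟨ +-monoˡ-≤ (M * M) (+-mono-≤ (+-mono-≤ deficit WD₁≤) WU₂≤) ⟩
    M * (Q + (D + U)) + M * D + M * U + M * M      ≤⟨ m≤m+n _ _ ⟩
    -- The nonnegative amount added here is what this estimate gives away. The bound M + w₀ ≤ N
    -- enters through `ν`.
    M * (Q + (D + U)) + M * D + M * U + M * M + (ν * (D + U) + w₀ * r + D + 2 * (w₀ * w₀))
      ≡⟨ balance w₀ e ν D U Q ⟩
    (Q + r) * e + (M + w₀ + ν) * (D + U) + (w₀ * w₀ + D + w₀ * (2 * M + (Q + r)))
      ≡⟨ cong₂ (λ x y → x * e + y * (D + U) + (w₀ * w₀ + D + w₀ * (2 * M + x))) (sym N≡) (m+[n∸m]≡n M+w₀≤N) ⟩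
    N * e + N * (D + U) + (w₀ * w₀ + D + w₀ * (2 * M + N))
      ≡⟨ cong (_+ (w₀ * w₀ + D + w₀ * (2 * M + N))) (collect N e D U) ⟩
    N * r + (w₀ * w₀ + D + w₀ * (2 * M + N))       ∎)
  where
  open ≤-Reasoning
  M = w₀ + e
  r = e + D + U
  ν = N ∸ (M + w₀)
  S = WQ + (WU₁ + WD₁ + (WU₂ + WD₂))
  T = WQ + (WD₁ + WU₂)
  reorder : ∀ t x y z k → t + x + y + z + k ≡ t + k + x + y + z
  reorder = solve-∀
  collect : ∀ N e D U → N * e + N * (D + U) ≡ N * (e + D + U)
  collect = solve-∀
  balance : ∀ w₀ e ν D U Q → let M = w₀ + e; r = e + D + U in
    M * (Q + (D + U)) + M * D + M * U + M * M + (ν * (D + U) + w₀ * r + D + 2 * (w₀ * w₀)) ≡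
    (Q + r) * e + (M + w₀ + ν) * (D + U) + (w₀ * w₀ + D + w₀ * (2 * M + (Q + r)))
  balance = solve-∀
  before : ∀ WQ WU₁ WD₁ WU₂ WD₂ W e D →
    2 * (WQ + (WU₁ + WD₁ + (WU₂ + WD₂)) + (W + D)) + e ≡
    2 * (WQ + (WD₁ + WU₂)) + (W + (2 * WU₁ + (e + D + D))) + (W + 2 * WD₂)
  before = solve-∀
  after : ∀ WQ WD₁ WU₂ V e U →
    2 * (WQ + (WD₁ + WU₂)) + (V + 2 * WD₁) + (V + (2 * WU₂ + (U + (e + U)))) ≡
    2 * (WQ + (WD₁ + WU₂) + WD₁ + (WU₂ + U) + V) + e
  after = solve-∀
  -- The two energies eliminate WU₁ and WD₂, the weights of the moves along the trend. Since the
  -- energies carry a factor 2, the identity is proved doubled, with `e` added to both sides.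
  S≡ : S + (w₀ * w₀ + D) ≡ T + WD₁ + (WU₂ + U) + M * M
  S≡ = *-cancelˡ-≡ _ _ 2 (+-cancelʳ-≡ e _ _
    (trans (before WQ WU₁ WD₁ WU₂ WD₂ (w₀ * w₀) e D)
    (trans (cong₂ (λ x y → 2 * T + x + y) (sym energy₁) energy₂)
           (after WQ WD₁ WU₂ (M * M) e U))))

module Translates (p m : ℕ) (a : ℕ → Bool) (a-periodic : Periodic p a) where

  N : ℕ
  N = ∑[ n < p ] ⟦ a n ⟧

  w : ℕ → ℕ
  w n = ∑[ i < m ] ⟦ a (n + i) ⟧

  gain : (ℕ → Bool) → ℕ → ℕ
  gain c j = ∑[ n < p ] ⟦ not (c n) ∧ a (n + j) ⟧

  s-periodic : Periodic p (λ n → ⟦ a n ⟧)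
  s-periodic n = cong ⟦_⟧ (a-periodic n)

  w-periodic : Periodic p w
  w-periodic n = ∑-≗ m (λ i → trans (cong (λ k → ⟦ a k ⟧) (+-assoc p n i)) (s-periodic (n + i)))

  ∑s+ : ∀ k → ∑[ n < p ] ⟦ a (n + k) ⟧ ≡ N
  ∑s+ = ∑-periodicʳ s-periodic

  ∑w : ∑ p w ≡ m * N
  ∑w = trans (∑-swap p m (λ n i → ⟦ a (n + i) ⟧)) (trans (∑-≗ m ∑s+) (∑-const m N))

  gain≤N : ∀ c j → gain c j ≤ N
  gain≤N c j = ≤-trans (∑-mono p (λ n _ → lemma (c n) (a (n + j)))) (≤-reflexive (∑s+ j))
    where
    lemma : ∀ x y → ⟦ not x ∧ y ⟧ ≤ ⟦ y ⟧
    lemma true  y = z≤n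
    lemma false y = ≤-refl

  -- Double counting: a point n outside `c` lies in A - j for exactly `w n` of the shifts j < m, so
  -- the gains sum to m N minus the weight of `c`. The best shift does at least as well as the
  -- average.
  average-gain : .{{_ : NonZero m}} → ∀ c →
    ∃[ j ] j < m × m * N ≤ m * gain c j + ∑[ n < p ] (w n * ⟦ c n ⟧)
  average-gain c with pigeonhole m (gain c)
  ... | j , j<m , avg = j , j<m , (begin
    m * N                                                      ≡⟨ ∑w ⟨
    ∑ p w                                                      ≡⟨ ∑-≗ p pointwise ⟨
    ∑[ n < p ] (g n + w n * ⟦ c n ⟧)                           ≡⟨ ∑-+ p g _ ⟩
    ∑ p g + ∑[ n < p ] (w n * ⟦ c n ⟧)
      ≡⟨ cong (_+ ∑[ n < p ] (w n * ⟦ c n ⟧)) (∑-swap p m (λ n i → ⟦ not (c n) ∧ a (n + i) ⟧)) ⟩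
    ∑ m (gain c) + ∑[ n < p ] (w n * ⟦ c n ⟧)                  ≤⟨ +-monoˡ-≤ _ avg ⟩
    m * gain c j + ∑[ n < p ] (w n * ⟦ c n ⟧)                  ∎)
    where
    open ≤-Reasoning
    g : ℕ → ℕ
    g n = ∑[ i < m ] ⟦ not (c n) ∧ a (n + i) ⟧
    pointwise : ∀ n → g n + w n * ⟦ c n ⟧ ≡ w n
    pointwise n with c n
    ... | true  rewrite ∑-const m 0 | *-zeroʳ m = *-identityʳ (w n)
    ... | false rewrite *-zeroʳ (w n) = +-identityʳ (w n)

  -- The goal for translates A - i, with m standing for |B| - 1. All m + 1 shifts from 0 to m are
  -- allowed. Averaging uses only j < m, while the dense case also needs the shift m itself.
  Spread : Set
  Spread = ∃[ i ] ∃[ j ] ∃[ k ] i ≤ m × j ≤ m × k ≤ m ×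
    N + m ≤ ∑[ n < p ] ⟦ (a (n + i) ∨ a (n + j)) ∨ a (n + k) ⟧

  -- When w ≤ m/3 the weight of `c` is at most m |c| / 3, so the average gain is at least N - |c| /
  -- 3.
  sparse-gain : .{{_ : NonZero m}} → ∀ {M} → (∀ n → w n ≤ M) → 3 * M ≤ m → ∀ c →
    ∃[ j ] j < m × 3 * N ≤ 3 * gain c j + ∑[ n < p ] ⟦ c n ⟧
  sparse-gain {M} w≤M 3M≤m c with average-gain c
  ... | j , j<m , avg = j , j<m , *-cancelˡ-≤ m (begin
    m * (3 * N)                                            ≡⟨ x*[3*y] m N ⟩
    3 * (m * N)                                            ≤⟨ *-monoʳ-≤ 3 avg ⟩
    3 * (m * gain c j + ∑[ n < p ] (w n * ⟦ c n ⟧))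
      ≤⟨ *-monoʳ-≤ 3 (+-monoʳ-≤ (m * gain c j) (∑-mono p (λ n _ → *-monoˡ-≤ ⟦ c n ⟧ (w≤M n)))) ⟩
    3 * (m * gain c j + ∑[ n < p ] (M * ⟦ c n ⟧))
      ≡⟨ cong (λ x → 3 * (m * gain c j + x)) (∑-*ˡ p M _) ⟩
    3 * (m * gain c j + M * C)                             ≡⟨ lemma m (gain c j) M C ⟩
    m * (3 * gain c j) + 3 * M * C                         ≤⟨ +-monoʳ-≤ _ (*-monoˡ-≤ C 3M≤m) ⟩
    m * (3 * gain c j) + m * C                             ≡⟨ *-distribˡ-+ m _ C ⟨
    m * (3 * gain c j + C)                                 ∎)
    where
    open ≤-Reasoning
    C = ∑[ n < p ] ⟦ c n ⟧
    x*[3*y] : ∀ x y → x * (3 * y) ≡ 3 * (x * y)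
    x*[3*y] = solve-∀
    lemma : ∀ x g M C → 3 * (x * g + M * C) ≡ x * (3 * g) + 3 * M * C
    lemma = solve-∀

  -- Two greedy steps: G₁ ≥ N - N/3 and G₂ ≥ N - (N + G₁)/3. Adding them and using G₁ ≤ N gives G₁ +
  -- G₂ ≥ N ≥ m.
  sparse⇒spread : .{{_ : NonZero m}} → m ≤ N → ∀ {M} → (∀ n → w n ≤ M) → 3 * M ≤ m → Spread
  sparse⇒spread m≤N w≤M 3M≤m with sparse-gain w≤M 3M≤m (λ n → a (n + 0))
  ... | j , j<m , gain₁ with sparse-gain w≤M 3M≤m (λ n → a (n + 0) ∨ a (n + j))
  ... | k , k<m , gain₂ = 0 , j , k , z≤n , <⇒≤ j<m , <⇒≤ k<m , (begin
    N + m                ≤⟨ +-monoʳ-≤ N m≤N ⟩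
    N + N                ≤⟨ +-monoʳ-≤ N (*-cancelˡ-≤ 3 enough) ⟩
    N + (G₁ + G₂)        ≡⟨ +-assoc N G₁ G₂ ⟨
    N + G₁ + G₂          ≡⟨ cong (_+ G₂) (sym C₂≡) ⟩
    ∑ p (λ n → ⟦ c₂ n ⟧) + G₂   ≡⟨ ∑-∨ p c₂ _ ⟨
    ∑[ n < p ] ⟦ c₂ n ∨ a (n + k) ⟧ ∎)
    where
    open ≤-Reasoning
    c₁ c₂ : ℕ → Bool
    c₁ n = a (n + 0)
    c₂ n = a (n + 0) ∨ a (n + j)
    G₁ = gain c₁ j
    G₂ = gain c₂ k
    C₂≡ : ∑[ n < p ] ⟦ c₂ n ⟧ ≡ N + G₁
    C₂≡ = trans (∑-∨ p c₁ _) (cong (_+ G₁) (∑s+ 0))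
    combine : ∀ x y z → 3 * x + y + (3 * z + (y + x)) ≡ 3 * (x + z) + (2 * y + x)
    combine = solve-∀
    enough : 3 * N ≤ 3 * (G₁ + G₂)
    enough = +-cancelʳ-≤ (3 * N) _ _ (begin
      3 * N + 3 * N                          ≤⟨ +-mono-≤ gain₁ gain₂ ⟩
      3 * G₁ + ∑[ n < p ] ⟦ c₁ n ⟧ + (3 * G₂ + ∑[ n < p ] ⟦ c₂ n ⟧)
        ≡⟨ cong₂ (λ x y → 3 * G₁ + x + (3 * G₂ + y)) (∑s+ 0) C₂≡ ⟩
      3 * G₁ + N + (3 * G₂ + (N + G₁))       ≡⟨ combine G₁ N G₂ ⟩
      3 * (G₁ + G₂) + (2 * N + G₁)           ≤⟨ +-monoʳ-≤ (3 * (G₁ + G₂)) (+-monoʳ-≤ (2 * N) (gain≤N c₁ j)) ⟩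
      3 * (G₁ + G₂) + (2 * N + N)            ≡⟨ cong (3 * (G₁ + G₂) +_) (+-comm (2 * N) N) ⟩
      3 * (G₁ + G₂) + 3 * N                  ∎)

  -- The walk of `w` as the window slides around the circle

  both leaves enters : ℕ → ℕ
  both   n = ⟦ a n ∧ a (n + m) ⟧
  leaves n = ⟦ a n ∧ not (a (n + m)) ⟧
  enters n = ⟦ not (a n) ∧ a (n + m) ⟧

  both+leaves : ∀ n → both n + leaves n ≡ ⟦ a n ⟧
  both+leaves n with a n | a (n + m)
  ... | true  | true  = refl
  ... | true  | false = refl
  ... | false | _     = refl

  both+enters : ∀ n → both n + enters n ≡ ⟦ a (n + m) ⟧
  both+enters n with a n | a (n + m)
  ... | true  | true  = refl
  ... | true  | false = refl
  ... | false | _     = refl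

  -- After adding `both n`, each side counts the points of A among the m + 1 positions n, ..., n +
  -- m: the left splits off the first position, the right the last.
  w-step : ∀ n → w (suc n) + leaves n ≡ w n + enters n
  w-step n = +-cancelʳ-≡ (both n) _ _ (begin
    w (suc n) + leaves n + both n     ≡⟨ lemma (w (suc n)) (leaves n) (both n) ⟩
    both n + leaves n + w (suc n)     ≡⟨ cong₂ _+_ (trans (both+leaves n) (cong (λ k → ⟦ a k ⟧) (sym (+-identityʳ n))))
                                          (∑-≗ m (λ i → cong (λ k → ⟦ a k ⟧) (sym (+-suc n i)))) ⟩
    ∑ 1 (λ i → ⟦ a (n + i) ⟧) + ∑[ i < m ] ⟦ a (n + (1 + i)) ⟧ ≡⟨ ∑-split 1 m _ ⟨
    w n + ⟦ a (n + m) ⟧               ≡⟨ cong (w n +_) (both+enters n) ⟨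
    w n + (both n + enters n)         ≡⟨ lemma₂ (w n) (both n) (enters n) ⟩
    w n + enters n + both n           ∎)
    where
    open ≡-Reasoning
    lemma : ∀ x y z → x + y + z ≡ z + y + x
    lemma = solve-∀
    lemma₂ : ∀ x y z → x + (y + z) ≡ x + z + y
    lemma₂ = solve-∀

  drift : ∀ k l → w (k + l) + ∑[ i < l ] leaves (k + i) ≡ w k + ∑[ i < l ] enters (k + i)
  drift = ∑-telescope w leaves enters w-step

  -- Telescoping w². The signed sum of w over all moves thus depends only on the end values and on
  -- the number of moves.
  energy : ∀ k l →
    w (k + l) * w (k + l) + 2 * ∑[ i < l ] (w (k + i) * leaves (k + i)) ≡
    w k * w k + (2 * ∑[ i < l ] (w (k + i) * enters (k + i)) +
                 (∑[ i < l ] enters (k + i) + ∑[ i < l ] leaves (k + i)))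
  energy k l = begin
    w (k + l) * w (k + l) + 2 * ∑[ i < l ] (w (k + i) * leaves (k + i))
      ≡⟨ cong (w (k + l) * w (k + l) +_) (∑-*ˡ l 2 _) ⟨
    w (k + l) * w (k + l) + ∑[ i < l ] g (k + i)
      ≡⟨ ∑-telescope (λ n → w n * w n) g h
           (λ n → step-square (a n) (a (n + m)) (w n) (w (suc n)) (w-step n)) k l ⟩
    w k * w k + ∑[ i < l ] h (k + i)
      ≡⟨ cong (w k * w k +_) (trans (∑-+ l _ _) (cong₂ _+_ (∑-*ˡ l 2 _) (∑-+ l _ _))) ⟩
    w k * w k + (2 * ∑[ i < l ] (w (k + i) * enters (k + i)) +
                 (∑[ i < l ] enters (k + i) + ∑[ i < l ] leaves (k + i))) ∎
    where
    open ≡-Reasoning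
    g h : ℕ → ℕ
    g n = 2 * (w n * leaves n)
    h n = 2 * (w n * enters n) + (enters n + leaves n)

  ∑-double-window : ∀ n → ∑[ i < m + m ] ⟦ a (n + i) ⟧ ≡ w n + w (n + m)
  ∑-double-window n = trans (∑-split m m _)
    (cong (w n +_) (∑-≗ m (λ i → cong (λ k → ⟦ a k ⟧) (sym (+-assoc n m i)))))

  -- The window at n + i is covered by the two adjacent windows at n and n + m.
  w-between : ∀ n {i} → i ≤ m → w (n + i) ≤ w n + w (n + m)
  w-between n {i} i≤m = begin
    ∑[ j < m ] ⟦ a (n + i + j) ⟧      ≡⟨ ∑-≗ m (λ j → cong (λ k → ⟦ a k ⟧) (+-assoc n i j)) ⟩
    ∑[ j < m ] ⟦ a (n + (i + j)) ⟧    ≤⟨ m≤n+m _ _ ⟩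
    ∑ i (λ j → ⟦ a (n + j) ⟧) + ∑[ j < m ] ⟦ a (n + (i + j)) ⟧  ≡⟨ ∑-split i m _ ⟨
    ∑[ j < i + m ] ⟦ a (n + j) ⟧      ≤⟨ ∑-monoˡ _ (+-monoˡ-≤ m i≤m) ⟩
    ∑[ j < m + m ] ⟦ a (n + j) ⟧      ≡⟨ ∑-double-window n ⟩
    w n + w (n + m)                   ∎
    where open ≤-Reasoning

  -- Only windows inside the stretch are counted, and each point lies in at most m of them. For l ≤
  -- m the left side is an empty sum.
  window-count : ∀ g k l →
    ∑[ n < l ∸ m ] (∑[ i < m ] g (k + n + i)) ≤ m * ∑[ n < l ] g (k + n)
  window-count g k l with ≤-total l m
  ... | inj₁ l≤m rewrite m≤n⇒m∸n≡0 l≤m = z≤n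
  ... | inj₂ m≤l = begin
    ∑[ n < l ∸ m ] (∑[ i < m ] g (k + n + i))  ≡⟨ ∑-swap (l ∸ m) m (λ n i → g (k + n + i)) ⟩
    ∑[ i < m ] (∑[ n < l ∸ m ] g (k + n + i))  ≤⟨ ∑-mono m shifted ⟩
    ∑[ i < m ] (∑[ n < l ] g (k + n))          ≡⟨ ∑-const m _ ⟩
    m * ∑[ n < l ] g (k + n)                   ∎
    where
    open ≤-Reasoning
    lemma : ∀ k n i → k + n + i ≡ k + (i + n)
    lemma = solve-∀
    shifted : ∀ i → i < m → ∑[ n < l ∸ m ] g (k + n + i) ≤ ∑[ n < l ] g (k + n)
    shifted i i<m = begin
      ∑[ n < l ∸ m ] g (k + n + i)      ≡⟨ ∑-≗ (l ∸ m) (λ n → cong g (lemma k n i)) ⟩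
      ∑[ n < l ∸ m ] g (k + (i + n))    ≤⟨ m≤n+m _ _ ⟩
      ∑ i (λ n → g (k + n)) + ∑[ n < l ∸ m ] g (k + (i + n))  ≡⟨ ∑-split i (l ∸ m) _ ⟨
      ∑[ n < i + (l ∸ m) ] g (k + n)
        ≤⟨ ∑-monoˡ _ (≤-trans (+-monoˡ-≤ (l ∸ m) (<⇒≤ i<m)) (≤-reflexive (m+[n∸m]≡n m≤l))) ⟩
      ∑[ n < l ] g (k + n)              ∎

  -- A window at n holds at least w₀ points marked by `x`, and at each of them w is at most
  -- `w n + w (n + m)`. So the window contributes at least w₀ (M - w n - w (n + m)). Summing over
  -- the windows inside the stretch counts each point at most m times.
  stretch : ∀ M w₀ (x : ℕ → ℕ) → (∀ n → w₀ ≤ ∑[ i < m ] x (n + i)) → ∀ k l →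
    (l ∸ m) * (w₀ * M) ≤
    m * ∑[ n < l ] ((M ∸ w (k + n)) * x (k + n)) + w₀ * ∑[ n < l ] (w (k + n) + w (k + n + m))
  stretch M w₀ x w₀≤ k l = begin
    (l ∸ m) * (w₀ * M)                                        ≡⟨ ∑-const (l ∸ m) _ ⟨
    ∑[ n < l ∸ m ] (w₀ * M)                                   ≤⟨ ∑-mono (l ∸ m) (λ n _ → pointwise (k + n)) ⟩
    ∑[ n < l ∸ m ] (∑[ i < m ] g (k + n + i) + w₀ * v (k + n)) ≡⟨ ∑-+ (l ∸ m) _ _ ⟩
    ∑[ n < l ∸ m ] (∑[ i < m ] g (k + n + i)) + ∑[ n < l ∸ m ] (w₀ * v (k + n))
      ≤⟨ +-mono-≤ (window-count g k l) (∑-monoˡ _ (m∸n≤m l m)) ⟩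
    m * ∑[ n < l ] g (k + n) + ∑[ n < l ] (w₀ * v (k + n))
      ≡⟨ cong (m * ∑[ n < l ] g (k + n) +_) (∑-*ˡ l w₀ _) ⟩
    m * ∑[ n < l ] g (k + n) + w₀ * ∑[ n < l ] v (k + n)      ∎
    where
    open ≤-Reasoning
    g v : ℕ → ℕ
    g n = (M ∸ w n) * x n
    v n = w n + w (n + m)
    pointwise : ∀ n → w₀ * M ≤ ∑[ i < m ] g (n + i) + w₀ * v n
    pointwise n = begin
      -- If `v n` exceeds M the truncated difference is 0 and the term `w₀ * v n` alone suffices.
      w₀ * M                                           ≤⟨ *-monoʳ-≤ w₀ (m≤n+m∸n M (v n)) ⟩
      w₀ * (v n + (M ∸ v n))                           ≡⟨ lemma w₀ (v n) (M ∸ v n) ⟩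
      (M ∸ v n) * w₀ + w₀ * v n                        ≤⟨ +-monoˡ-≤ _ (*-monoʳ-≤ (M ∸ v n) (w₀≤ n)) ⟩
      (M ∸ v n) * ∑[ i < m ] x (n + i) + w₀ * v n      ≡⟨ cong (_+ w₀ * v n) (∑-*ˡ m (M ∸ v n) _) ⟨
      ∑[ i < m ] ((M ∸ v n) * x (n + i)) + w₀ * v n
        ≤⟨ +-monoˡ-≤ _ (∑-mono m (λ i i<m →
             *-monoˡ-≤ (x (n + i)) (∸-monoʳ-≤ M (w-between n (<⇒≤ i<m))))) ⟩
      ∑[ i < m ] g (n + i) + w₀ * v n                  ∎
      where
      lemma : ∀ x y z → x * (y + z) ≡ z * x + x * y
      lemma = solve-∀

  -- The dense case: some window holds at least m/3 points

  module Dense .{{_ : NonZero m}} (m≤N : m ≤ N) (13N≤p : 13 * N ≤ p)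
    -- The circle is cut at a minimum of w, placed at 0. The maximum at `t` divides it into a
    -- stretch of length t before and one of length l after.
    (w-min : ∀ n → w 0 ≤ w n)
    (t l : ℕ) (t+l≡p : t + l ≡ p) (w-max : ∀ n → w n ≤ w t) (m≤3M : m ≤ 3 * w t)
    where

    M w₀ e : ℕ
    M  = w t
    w₀ = w 0
    e  = M ∸ w₀

    -- The windows at t and t + m are disjoint because 2m ≤ p. They hold M and at least w₀ points.
    M+w₀≤N : M + w₀ ≤ N
    M+w₀≤N = begin
      w t + w 0                             ≤⟨ +-monoʳ-≤ (w t) (w-min (t + m)) ⟩
      w t + w (t + m)                       ≡⟨ ∑-double-window t ⟨
      ∑[ i < m + m ] ⟦ a (t + i) ⟧          ≤⟨ ∑-monoˡ _ m+m≤p ⟩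
      ∑[ i < p ] ⟦ a (t + i) ⟧              ≡⟨ ∑-periodic s-periodic t ⟩
      N                                     ∎
      where
      open ≤-Reasoning
      lemma : ∀ x → x + x + 11 * x ≡ 13 * x
      lemma = solve-∀
      m+m≤p : m + m ≤ p
      m+m≤p = begin
        m + m           ≤⟨ +-mono-≤ m≤N m≤N ⟩
        N + N           ≤⟨ m≤m+n _ _ ⟩
        N + N + 11 * N  ≡⟨ lemma N ⟩
        13 * N          ≤⟨ 13N≤p ⟩
        p               ∎

    -- Before the maximum A consists of `both` and `leaves`; after it A - m consists of `both` and
    -- `enters`. These are the points where w stays or moves against the trend.
    slack₁ slack₂ : ℕ
    slack₁ = ∑[ n < t ] ((M ∸ w n) * ⟦ a n ⟧)
    slack₂ = ∑[ n < l ] ((M ∸ w (t + n)) * ⟦ a (t + n + m) ⟧)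

    -- The two stretches contain at least p - 2m windows, and w n + w (n + m) sums to 2mN over a
    -- period. Hence m times the slack is at least w₀ ((p - 2m) M - 2mN).
    slack-bound : w₀ * (2 * M + N) ≤ slack₁ + slack₂
    slack-bound = *-cancelˡ-≤ m (+-cancelʳ-≤ K _ _ (begin
      m * (w₀ * (2 * M + N)) + K                      ≡⟨ expand m w₀ M N ⟩
      w₀ * (4 * (m * M) + 3 * (m * N))
        ≤⟨ *-monoʳ-≤ w₀ (+-mono-≤ (*-monoʳ-≤ 4 (*-monoˡ-≤ M m≤N)) (*-monoʳ-≤ 3 (*-monoˡ-≤ N m≤3M))) ⟩
      -- The constant 13 is 4 + 9: m ≤ N bounds 4mM by 4NM, and m ≤ 3M bounds 3mN by 9MN.
      w₀ * (4 * (N * M) + 3 * (3 * M * N))            ≡⟨ thirteen w₀ M N ⟩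
      13 * N * (w₀ * M)                               ≤⟨ *-monoˡ-≤ (w₀ * M) (≤-trans 13N≤p p≤) ⟩
      ((t ∸ m) + (l ∸ m) + 2 * m) * (w₀ * M)
        ≡⟨ distrib (t ∸ m) (l ∸ m) (2 * m) (w₀ * M) ⟩
      (t ∸ m) * (w₀ * M) + (l ∸ m) * (w₀ * M) + 2 * m * (w₀ * M)
        ≤⟨ +-monoˡ-≤ _ (+-mono-≤
             (stretch M w₀ (λ n → ⟦ a n ⟧) w-min 0 t)
             (stretch M w₀ (λ n → ⟦ a (n + m) ⟧) window+m t l)) ⟩
      m * slack₁ + w₀ * ∑ t v + (m * slack₂ + w₀ * ∑[ n < l ] v (t + n)) + 2 * m * (w₀ * M)
        ≡⟨ regroup m slack₁ slack₂ w₀ (∑ t v) (∑[ n < l ] v (t + n)) (2 * m * (w₀ * M)) ⟩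
      m * (slack₁ + slack₂) + (w₀ * (∑ t v + ∑[ n < l ] v (t + n)) + 2 * m * (w₀ * M))
        ≡⟨ cong (λ x → m * (slack₁ + slack₂) + (w₀ * x + 2 * m * (w₀ * M))) ∑v ⟩
      m * (slack₁ + slack₂) + K                       ∎))
      where
      open ≤-Reasoning
      K = w₀ * (m * N + m * N) + 2 * m * (w₀ * M)
      v : ℕ → ℕ
      v n = w n + w (n + m)
      ∑v : ∑ t v + ∑[ n < l ] v (t + n) ≡ m * N + m * N
      ∑v = trans (sym (∑-split t l v)) (trans (cong (λ k → ∑ k v) t+l≡p)
        (trans (∑-+ p w _) (cong₂ _+_ ∑w (trans (∑-periodicʳ w-periodic m) ∑w))))
      window+m : ∀ n → w₀ ≤ ∑[ i < m ] ⟦ a (n + i + m) ⟧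
      window+m n = ≤-trans (w-min (n + m))
        (≤-reflexive (∑-≗ m (λ i → cong (λ k → ⟦ a k ⟧) (lemma n m i))))
        where
        lemma : ∀ n m i → n + m + i ≡ n + i + m
        lemma = solve-∀
      p≤ : p ≤ (t ∸ m) + (l ∸ m) + 2 * m
      p≤ = begin
        p                                ≡⟨ t+l≡p ⟨
        t + l                            ≤⟨ +-mono-≤ (m≤n+m∸n t m) (m≤n+m∸n l m) ⟩
        m + (t ∸ m) + (m + (l ∸ m))      ≡⟨ lemma m (t ∸ m) (l ∸ m) ⟩
        (t ∸ m) + (l ∸ m) + 2 * m        ∎
        where
        lemma : ∀ m x y → m + x + (m + y) ≡ x + y + 2 * m
        lemma = solve-∀
      expand : ∀ m w₀ M N → m * (w₀ * (2 * M + N)) + (w₀ * (m * N + m * N) + 2 * m * (w₀ * M)) ≡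
        w₀ * (4 * (m * M) + 3 * (m * N))
      expand = solve-∀
      thirteen : ∀ w₀ M N → w₀ * (4 * (N * M) + 3 * (3 * M * N)) ≡ 13 * N * (w₀ * M)
      thirteen = solve-∀
      distrib : ∀ x y z k → (x + y + z) * k ≡ x * k + y * k + z * k
      distrib = solve-∀
      regroup : ∀ m x y w₀ v₁ v₂ k →
        m * x + w₀ * v₁ + (m * y + w₀ * v₂) + k ≡ m * (x + y) + (w₀ * (v₁ + v₂) + k)
      regroup = solve-∀

    U : ℕ
    U = ∑ p enters

    before after : (ℕ → ℕ) → ℕ
    before f = ∑ t f
    after  f = ∑[ n < l ] f (t + n)

    before+after : ∀ f → before f + after f ≡ ∑ p f
    before+after f = trans (sym (∑-split t l f)) (cong (λ k → ∑ k f) t+l≡p)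

    weigh : (ℕ → ℕ) → ℕ → ℕ
    weigh f n = w n * f n

    complement : ∀ k n (x y z : ℕ → ℕ) → (∀ i → x i + y i ≡ z i) →
      ∑[ i < n ] weigh x (k + i) + ∑[ i < n ] weigh y (k + i) +
      ∑[ i < n ] ((M ∸ w (k + i)) * z (k + i)) ≡
      M * (∑[ i < n ] x (k + i) + ∑[ i < n ] y (k + i))
    complement k n x y z x+y≡z = trans
      (sym (trans (∑-+ n _ _) (cong (_+ ∑[ i < n ] ((M ∸ w (k + i)) * z (k + i))) (∑-+ n _ _))))
      (trans (∑-≗ n (λ i → pointwise (k + i))) (trans (∑-*ˡ n M _) (cong (M *_) (∑-+ n _ _))))
      where
      lemma : ∀ W V X Y → W * X + W * Y + V * (X + Y) ≡ (W + V) * (X + Y)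
      lemma = solve-∀
      pointwise : ∀ i → weigh x i + weigh y i + (M ∸ w i) * z i ≡ M * (x i + y i)
      pointwise i rewrite sym (x+y≡z i) =
        trans (lemma (w i) _ (x i) (y i)) (cong (_* (x i + y i)) (m+[n∸m]≡n (w-max i)))

    -- By `complement`, replacing the weight w by M on the points that define the slacks costs
    -- exactly `slack₁ + slack₂`.
    deficit : ∑ p (weigh both) + (before (weigh leaves) + after (weigh enters)) + w₀ * (2 * M + N) ≤
      M * (∑ p both + (before leaves + after enters))
    deficit = begin
      ∑ p (weigh both) + (before (weigh leaves) + after (weigh enters)) + w₀ * (2 * M + N)
        ≤⟨ +-monoʳ-≤ _ slack-bound ⟩
      ∑ p (weigh both) + (before (weigh leaves) + after (weigh enters)) + (slack₁ + slack₂)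
        ≡⟨ cong (λ x → x + (before (weigh leaves) + after (weigh enters)) + (slack₁ + slack₂))
             (before+after (weigh both)) ⟨
      before (weigh both) + after (weigh both) +
        (before (weigh leaves) + after (weigh enters)) + (slack₁ + slack₂)
        ≡⟨ interleave (before (weigh both)) (after (weigh both)) (before (weigh leaves)) _ slack₁ slack₂ ⟩
      before (weigh both) + before (weigh leaves) + slack₁ +
        (after (weigh both) + after (weigh enters) + slack₂)
        ≡⟨ cong₂ _+_ (complement 0 t both leaves (λ n → ⟦ a n ⟧) both+leaves)
             (complement t l both enters (λ n → ⟦ a (n + m) ⟧) both+enters) ⟩
      M * (before both + before leaves) + M * (after both + after enters)
        ≡⟨ gather M (before both) (after both) (before leaves) (after enters) ⟩
      M * (before both + after both + (before leaves + after enters))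
        ≡⟨ cong (λ x → M * (x + (before leaves + after enters))) (before+after both) ⟩
      M * (∑ p both + (before leaves + after enters)) ∎
      where
      open ≤-Reasoning
      interleave : ∀ q q′ x y s s′ → q + q′ + (x + y) + (s + s′) ≡ q + x + s + (q′ + y + s′)
      interleave = solve-∀
      gather : ∀ M q q′ x y → M * (q + x) + M * (q′ + y) ≡ M * (q + q′ + (x + y))
      gather = solve-∀

    -- A point of `enters` raises w by 1, and the new value is still at most M.
    enters-below-max : ∀ n → w n * enters n + enters n ≤ M * enters n
    enters-below-max n = ≤-trans (≤-reflexive (+-comm (w n * enters n) (enters n)))
      (helper (enters n) (leaves n) (exclusive (a n) (a (n + m))) (w-step n) (w-max (suc n)))
      where
      exclusive : ∀ b c → ⟦ not b ∧ c ⟧ ≡ 0 ⊎ (⟦ not b ∧ c ⟧ ≡ 1 × ⟦ b ∧ not c ⟧ ≡ 0)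
      exclusive true  _     = inj₁ refl
      exclusive false true  = inj₂ (refl , refl)
      exclusive false false = inj₁ refl
      helper : ∀ u d → u ≡ 0 ⊎ (u ≡ 1 × d ≡ 0) → ∀ {y} → y + d ≡ w n + u → y ≤ M →
        u + w n * u ≤ M * u
      helper u d (inj₁ refl) _ _ rewrite *-zeroʳ (w n) = z≤n
      helper u d (inj₂ (refl , refl)) {y} eq y≤M
        rewrite *-identityʳ (w n) | *-identityʳ M =
        subst (_≤ M) (trans (sym (+-identityʳ y)) (trans eq (+-comm (w n) 1))) y≤M

    -- The left side is the weight of `c`, sorted by kind of move and by stretch, as
    -- `excursion-arith` expects it.
    key : ∑ p (weigh both) + (before (weigh enters) + before (weigh leaves) +
            (after (weigh enters) + after (weigh leaves))) ≤ N * (before enters + after enters)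
    key = excursion-arith N (∑ p both) (∑ p (weigh both))
      (before leaves) (before (weigh leaves)) (before enters) (before (weigh enters))
      (after leaves) (after (weigh leaves)) (after enters) (after (weigh enters))
      (m+[n∸m]≡n (w-max 0))
      (drift 0 t)
      (energy 0 t)
      (trans (cong (_+ after leaves) (sym w-end)) (drift t l))
      (trans (cong (λ x → x * x + 2 * after (weigh leaves)) (sym w-end)) (energy t l))
      N≡
      M+w₀≤N
      (≤-trans (∑-mono t (λ n _ → *-monoˡ-≤ (leaves n) (w-max n))) (≤-reflexive (∑-*ˡ t M _)))
      (≤-trans (≤-reflexive (sym (∑-+ l _ _)))
        (≤-trans (∑-mono l (λ n _ → enters-below-max (t + n))) (≤-reflexive (∑-*ˡ l M _))))
      deficit
      where
      w-end : w (t + l) ≡ w₀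
      w-end = trans (cong w (trans t+l≡p (sym (+-identityʳ p)))) (w-periodic 0)
      -- N is counted here as the size of A - m, which is `both` together with `enters`.
      N≡ : N ≡ ∑ p both + (before enters + after enters)
      N≡ = trans (sym (∑s+ m)) (trans (∑-≗ p (λ n → sym (both+enters n)))
        (trans (∑-+ p both enters) (cong (∑ p both +_) (sym (before+after enters)))))

    c : ℕ → Bool
    c n = a (n + 0) ∨ a (n + m)

    ∑c : ∑[ n < p ] ⟦ c n ⟧ ≡ N + U
    ∑c = trans (∑-∨ p (λ n → a (n + 0)) (λ n → a (n + m))) (cong₂ _+_ (∑s+ 0)
      (∑-≗ p (λ n → cong (λ k → ⟦ not (a k) ∧ a (n + m) ⟧) (+-identityʳ n))))

    ∑wc≤ : ∑[ n < p ] (w n * ⟦ c n ⟧) ≤ N * U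
    ∑wc≤ = begin
      ∑[ n < p ] (w n * ⟦ c n ⟧)                                ≡⟨ ∑-≗ p pointwise ⟩
      ∑[ n < p ] (weigh both n + (weigh enters n + weigh leaves n))
        ≡⟨ trans (∑-+ p _ _) (cong (∑ p (weigh both) +_) (∑-+ p _ _)) ⟩
      ∑ p (weigh both) + (∑ p (weigh enters) + ∑ p (weigh leaves))
        ≡⟨ cong (∑ p (weigh both) +_)
             (cong₂ _+_ (before+after (weigh enters)) (before+after (weigh leaves))) ⟨
      ∑ p (weigh both) + (before (weigh enters) + after (weigh enters) +
        (before (weigh leaves) + after (weigh leaves)))
        ≡⟨ cong (∑ p (weigh both) +_) (interchange (before (weigh enters)) _ _ _) ⟩
      ∑ p (weigh both) + (before (weigh enters) + before (weigh leaves) +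
        (after (weigh enters) + after (weigh leaves)))          ≤⟨ key ⟩
      N * (before enters + after enters)                        ≡⟨ cong (N *_) (before+after enters) ⟩
      N * U                                                     ∎
      where
      open ≤-Reasoning
      interchange : ∀ x y z k → x + y + (z + k) ≡ x + z + (y + k)
      interchange = solve-∀
      cases : ∀ x y → ⟦ x ∨ y ⟧ ≡ ⟦ x ∧ y ⟧ + (⟦ not x ∧ y ⟧ + ⟦ x ∧ not y ⟧)
      cases true  true  = refl
      cases true  false = refl
      cases false true  = refl
      cases false false = refl
      distrib : ∀ k x y z → k * (x + (y + z)) ≡ k * x + (k * y + k * z)
      distrib = solve-∀
      pointwise : ∀ n → w n * ⟦ c n ⟧ ≡ weigh both n + (weigh enters n + weigh leaves n)
      pointwise n rewrite +-identityʳ n =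
        trans (cong (w n *_) (cases (a n) (a (n + m)))) (distrib (w n) _ _ _)

    spread : Spread
    spread with average-gain c
    ... | j , j<m , avg = 0 , m , j , z≤n , ≤-refl , <⇒≤ j<m , (begin
      N + m                                ≤⟨ +-monoʳ-≤ N (m≤n+m∸n m U) ⟩
      N + (U + (m ∸ U))                    ≤⟨ +-monoʳ-≤ N (+-monoʳ-≤ U (rest (≤-total m U))) ⟩
      N + (U + gain c j)                   ≡⟨ +-assoc N U _ ⟨
      N + U + gain c j                     ≡⟨ cong (_+ gain c j) ∑c ⟨
      ∑[ n < p ] ⟦ c n ⟧ + gain c j        ≡⟨ ∑-∨ p c _ ⟨
      ∑[ n < p ] ⟦ c n ∨ a (n + j) ⟧       ∎)
      where
      open ≤-Reasoning
      rest : m ≤ U ⊎ U ≤ m → m ∸ U ≤ gain c j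
      rest (inj₁ m≤U) rewrite m≤n⇒m∸n≡0 m≤U = z≤n
      -- Here m gain ≥ mN - NU = N (m - U) ≥ m (m - U). In the other case A and A - m already have
      -- enough points.
      rest (inj₂ U≤m) = *-cancelˡ-≤ m (+-cancelʳ-≤ (N * U) _ _ (begin
        m * (m ∸ U) + N * U        ≤⟨ +-monoˡ-≤ _ (*-monoˡ-≤ (m ∸ U) m≤N) ⟩
        N * (m ∸ U) + N * U        ≡⟨ *-distribˡ-+ N (m ∸ U) U ⟨
        N * (m ∸ U + U)            ≡⟨ cong (N *_) (m∸n+n≡m U≤m) ⟩
        N * m                      ≡⟨ *-comm N m ⟩
        m * N                      ≤⟨ avg ⟩
        m * gain c j + ∑[ n < p ] (w n * ⟦ c n ⟧)  ≤⟨ +-monoʳ-≤ _ ∑wc≤ ⟩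
        m * gain c j + N * U       ∎))

-- Combining the sparse and dense cases

spread : ∀ p m a .{{_ : NonZero p}} (a-periodic : Periodic p a) →
  let open Translates p m a a-periodic in m ≤ N → 13 * N ≤ p → Spread
-- There are no shifts to average over; the single translate A has the N points required.
spread p zero a a-periodic _ _ = 0 , 0 , 0 , z≤n , z≤n , z≤n , (begin
  N + 0                                                  ≡⟨ +-identityʳ N ⟩
  N                                                      ≡⟨ ∑-≗ p (λ n → idem (a n) (cong a (+-identityʳ n))) ⟩
  ∑[ n < p ] ⟦ (a (n + 0) ∨ a (n + 0)) ∨ a (n + 0) ⟧    ∎)
  where
  open ≤-Reasoning
  open Translates p 0 a a-periodic
  idem : ∀ x {y} → y ≡ x → ⟦ x ⟧ ≡ ⟦ (y ∨ y) ∨ y ⟧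
  idem true  refl = refl
  idem false refl = refl
spread p m@(suc _) a a-periodic m≤N 13N≤p = rotate-back spread′
  where
  open Translates p m a a-periodic
  open ≤-Reasoning
  n₀ : ℕ
  n₀ = proj₁ (∃-min p w)
  -- Replacing A by A - n₀ moves the minimum of w to 0. `rotate-back` undoes this, since the size of
  -- a union over a period is invariant under rotation.
  module R = Translates p m (λ n → a (n₀ + n)) (periodic-shift a-periodic n₀)
  N′≡N : R.N ≡ N
  N′≡N = ∑-periodic s-periodic n₀
  w₀-min : ∀ n → w n₀ ≤ w n
  w₀-min n = ≤-trans (proj₂ (proj₂ (∃-min p w)) (n % p) (m%n<n n p))
    (≤-reflexive (periodic-% w-periodic n))
  w′-min : ∀ n → R.w 0 ≤ R.w n
  w′-min n = ≤-trans (w₀-min (n₀ + n))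
    (≤-reflexive (∑-≗ m (λ i → cong (λ k → ⟦ a k ⟧) (+-assoc n₀ n i))))
  spread′ : R.Spread
  spread′ with ∃-max p R.w
  ... | t , t<p , max = split (≤-total (3 * R.w t) m)
    where
    m≤N′ : m ≤ R.N
    m≤N′ = subst (m ≤_) (sym N′≡N) m≤N
    w′-max : ∀ n → R.w n ≤ R.w t
    w′-max n = ≤-trans (≤-reflexive (sym (periodic-% R.w-periodic n))) (max (n % p) (m%n<n n p))
    split : 3 * R.w t ≤ m ⊎ m ≤ 3 * R.w t → R.Spread
    split (inj₁ 3M≤m) = R.sparse⇒spread m≤N′ w′-max 3M≤m
    split (inj₂ m≤3M) = R.Dense.spread m≤N′ (subst (λ x → 13 * x ≤ p) (sym N′≡N) 13N≤p)
      w′-min t (p ∸ t) (m+[n∸m]≡n (<⇒≤ t<p)) w′-max m≤3M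
  rotate-back : R.Spread → Spread
  rotate-back (i , j , k , i≤m , j≤m , k≤m , N+m≤) = i , j , k , i≤m , j≤m , k≤m , (begin
    N + m                        ≡⟨ cong (_+ m) N′≡N ⟨
    R.N + m                      ≤⟨ N+m≤ ⟩
    ∑[ n < p ] ⟦ (a (n₀ + (n + i)) ∨ a (n₀ + (n + j))) ∨ a (n₀ + (n + k)) ⟧
      ≡⟨ ∑-≗ p (λ n → h-cong (a∘+ n i) (a∘+ n j) (a∘+ n k)) ⟨
    ∑[ n < p ] h (n₀ + n)        ≡⟨ ∑-periodic h-periodic n₀ ⟩
    ∑ p h                        ∎)
    where
    h : ℕ → ℕ
    h n = ⟦ (a (n + i) ∨ a (n + j)) ∨ a (n + k) ⟧
    h-cong : ∀ {x x′ y y′ z z′} → x ≡ x′ → y ≡ y′ → z ≡ z′ → ⟦ (x ∨ y) ∨ z ⟧ ≡ ⟦ (x′ ∨ y′) ∨ z′ ⟧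
    h-cong refl refl refl = refl
    a∘+ : ∀ n i → a (n₀ + n + i) ≡ a (n₀ + (n + i))
    a∘+ n i = cong a (+-assoc n₀ n i)
    a-p+ : ∀ n i → a (p + n + i) ≡ a (n + i)
    a-p+ n i = trans (cong a (+-assoc p n i)) (a-periodic (n + i))
    h-periodic : Periodic p h
    h-periodic n = h-cong (a-p+ n i) (a-p+ n j) (a-p+ n k)

-- Subsets of ℤ/p as periodic functions

toℕ-mod : ∀ n p .{{_ : NonZero p}} → toℕ (n mod p) ≡ n % p
toℕ-mod n p = toℕ-fromℕ< (m%n<n n p)

mod-periodic : ∀ p .{{_ : NonZero p}} → Periodic p (_mod p)
mod-periodic p n = toℕ-injective (trans (toℕ-mod (p + n) p)
  (trans (cong (_% p) (+-comm p n)) (trans ([m+n]%n≡m%n n p) (sym (toℕ-mod n p)))))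

mod-toℕ : ∀ {p} .{{_ : NonZero p}} (i : Fin p) → toℕ i mod p ≡ i
mod-toℕ {p} i = toℕ-injective (trans (toℕ-mod (toℕ i) p) (m<n⇒m%n≡m (toℕ<n i)))

mod-⊕ : ∀ u v p .{{_ : NonZero p}} → (u mod p) ⊕ (v mod p) ≡ (u + v) mod p
mod-⊕ u v p@(suc _) = begin
  (toℕ (u mod p) + toℕ (v mod p)) mod p  ≡⟨ cong₂ (λ x y → (x + y) mod p) (toℕ-mod u p) (toℕ-mod v p) ⟩
  (u % p + v % p) mod p                  ≡⟨ periodic-% (shiftʳ (v % p)) u ⟩
  (u + v % p) mod p                      ≡⟨ periodic-% (periodic-shift (mod-periodic p) u) v ⟩
  (u + v) mod p                          ∎
  where
  open ≡-Reasoning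
  shiftʳ : ∀ k → Periodic p (λ n → (n + k) mod p)
  shiftʳ k n = trans (cong (_mod p) (+-assoc p n k)) (mod-periodic p (n + k))

∣∣≡∑ : ∀ {n} (A : Subset n) (f : ℕ → Bool) → (∀ i → f (toℕ i) ≡ lookup A i) →
  ∣ A ∣ ≡ ∑[ i < n ] ⟦ f i ⟧
∣∣≡∑ {zero}  []      f f≗A = refl
∣∣≡∑ {suc n} (b ∷ A) f f≗A = trans (head b) (trans
  (cong₂ _+_ (cong ⟦_⟧ (sym (f≗A Fin.zero))) (∣∣≡∑ A (f ∘ suc) (f≗A ∘ Fin.suc)))
  (sym (∑-split 1 n _)))
  where
  head : ∀ b → ∣ b ∷ A ∣ ≡ ⟦ b ⟧ + ∣ A ∣
  head true  = refl
  head false = refl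

module _ {p-1 : ℕ} where

  private
    p : ℕ
    p = suc p-1

  χ : Subset p → ℕ → Bool
  χ A n = lookup A (n mod p)

  χ-periodic : ∀ A → Periodic p (χ A)
  χ-periodic A n = cong (lookup A) (mod-periodic p n)

  ∣∣≡∑χ : ∀ A → ∣ A ∣ ≡ ∑[ n < p ] ⟦ χ A n ⟧
  ∣∣≡∑χ A = ∣∣≡∑ A (χ A) (λ i → cong (lookup A) (mod-toℕ i))

  ⊕∈⊞ : ∀ {A T : Subset p} {x y} → x ∈ A → y ∈ T → x ⊕ y ∈ A ⊞ T
  ⊕∈⊞ {A} {T} {x} {y} x∈A y∈T = lookup⇒[]= (x ⊕ y) (A ⊞ T) (trans (lookup∘tabulate (λ z → does (covers z)) (x ⊕ y))
    (dec-true (covers (x ⊕ y)) (x , y , x∈A , y∈T , refl)))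
    where
    covers : ∀ z → Dec (∃[ x ] ∃[ y ] x ∈ A × y ∈ T × z ≡ x ⊕ y)
    covers z = any? λ x → any? λ y → (x ∈? A) ×-dec ((y ∈? T) ×-dec (z ≟ x ⊕ y))

  -- Rotating by -x, written `p ∸ toℕ x`, carries the interval to the residues 0, ..., d.
  ∣interval∣≤ : ∀ (x y : Fin p) → ∣ [ x ⋯ y ] ∣ ≤ suc (toℕ (y ⊖ x))
  ∣interval∣≤ x y = begin
    ∣ [ x ⋯ y ] ∣                       ≡⟨ ∣∣≡∑ [ x ⋯ y ] (λ z → f (z + (p ∸ toℕ x))) agree ⟩
    ∑[ z < p ] ⟦ f (z + (p ∸ toℕ x)) ⟧
      ≡⟨ ∑-periodicʳ (λ n → cong (λ i → ⟦ does (toℕ i ≤? d) ⟧) (mod-periodic p n)) (p ∸ toℕ x) ⟩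
    ∑[ z < p ] ⟦ f z ⟧                  ≡⟨ cong (λ k → ∑[ z < k ] ⟦ f z ⟧) (m+[n∸m]≡n 1+d≤p) ⟨
    ∑[ z < suc d + (p ∸ suc d) ] ⟦ f z ⟧ ≡⟨ ∑-split (suc d) (p ∸ suc d) _ ⟩
    ∑[ z < suc d ] ⟦ f z ⟧ + ∑[ z < p ∸ suc d ] ⟦ f (suc d + z) ⟧
      ≤⟨ +-mono-≤ (∑-mono (suc d) (λ z _ → ⟦⟧≤1 (f z))) (≤-reflexive (∑-cong (p ∸ suc d) beyond)) ⟩
    ∑[ z < suc d ] 1 + ∑[ z < p ∸ suc d ] 0
      ≡⟨ cong₂ _+_ (∑-const (suc d) 1) (∑-const (p ∸ suc d) 0) ⟩
    suc d * 1 + (p ∸ suc d) * 0         ≡⟨ cong₂ _+_ (*-identityʳ (suc d)) (*-zeroʳ (p ∸ suc d)) ⟩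
    suc d + 0                           ≡⟨ +-identityʳ (suc d) ⟩
    suc d                               ∎
    where
    open ≤-Reasoning
    d = toℕ (y ⊖ x)
    1+d≤p : suc d ≤ p
    1+d≤p = toℕ<n (y ⊖ x)
    f : ℕ → Bool
    f z = does (toℕ (z mod p) ≤? d)
    agree : ∀ z → f (toℕ z + (p ∸ toℕ x)) ≡ lookup [ x ⋯ y ] z
    agree z = sym (lookup∘tabulate (λ z → does (toℕ (z ⊖ x) ≤? d)) z)
    beyond : ∀ z → z < p ∸ suc d → ⟦ f (suc d + z) ⟧ ≡ 0
    beyond z z< = cong ⟦_⟧ (dec-false (toℕ ((suc d + z) mod p) ≤? d) λ le →
      <⇒≱ (m≤m+n (suc d) z) (subst (_≤ d) (trans (toℕ-mod (suc d + z) p) (m<n⇒m%n≡m in-range)) le))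
      where
      in-range : suc d + z < p
      in-range = subst (suc d + z <_) (m+[n∸m]≡n 1+d≤p) (+-monoʳ-< (suc d) z<)

  ∈interval : ∀ (x y : Fin p) β → β ≤ toℕ (y ⊖ x) → (toℕ x + β) mod p ∈ [ x ⋯ y ]
  ∈interval x y β β≤d = lookup⇒[]= z [ x ⋯ y ] (trans (lookup∘tabulate (λ z → does (toℕ (z ⊖ x) ≤? toℕ (y ⊖ x))) z)
    (dec-true (toℕ (z ⊖ x) ≤? toℕ (y ⊖ x)) (subst (_≤ toℕ (y ⊖ x)) (sym z⊖x≡β) β≤d)))
    where
    open ≡-Reasoning
    z = (toℕ x + β) mod p
    cancel : ∀ x β y → x + β + y ≡ β + (x + y)
    cancel = solve-∀
    z⊖x≡β : toℕ (z ⊖ x) ≡ β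
    z⊖x≡β = begin
      toℕ (z ⊖ x)                                   ≡⟨ toℕ-mod (toℕ z + (p ∸ toℕ x)) p ⟩
      (toℕ z + (p ∸ toℕ x)) % p                     ≡⟨ cong (λ k → (k + (p ∸ toℕ x)) % p) (toℕ-mod (toℕ x + β) p) ⟩
      ((toℕ x + β) % p + (p ∸ toℕ x)) % p           ≡⟨ periodic-% {f = λ n → (n + (p ∸ toℕ x)) % p} shift (toℕ x + β) ⟩
      (toℕ x + β + (p ∸ toℕ x)) % p                 ≡⟨ cong (_% p) (cancel (toℕ x) β (p ∸ toℕ x)) ⟩
      (β + (toℕ x + (p ∸ toℕ x))) % p               ≡⟨ cong (λ k → (β + k) % p) (m+[n∸m]≡n (<⇒≤ (toℕ<n x))) ⟩
      (β + p) % p                                   ≡⟨ [m+n]%n≡m%n β p ⟩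
      β % p                                         ≡⟨ m<n⇒m%n≡m (≤-<-trans β≤d (toℕ<n (y ⊖ x))) ⟩
      β                                             ∎
      where
      swap : ∀ p n k → p + n + k ≡ n + k + p
      swap = solve-∀
      shift : Periodic p (λ n → (n + (p ∸ toℕ x)) % p)
      shift n = trans (cong (_% p) (swap p n (p ∸ toℕ x))) ([m+n]%n≡m%n (n + (p ∸ toℕ x)) p)

  -- The size bound gives |B| - 1 ≤ d, so the first |B| residues from x onwards stay inside the
  -- interval.
  interval-progression : ∀ {B : Subset p} → IsInterval B → ∃[ x ] ∣ B ∣ ∸ 1 ≤ p ×
    (∀ β → β ≤ ∣ B ∣ ∸ 1 → (toℕ {p} x + β) mod p ∈ B)
  interval-progression (x , y , refl) =
    x , ≤-trans size (<⇒≤ (toℕ<n (y ⊖ x))) , λ β β≤ → ∈interval x y β (≤-trans β≤ size)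
    where
    size : ∣ [ x ⋯ y ] ∣ ∸ 1 ≤ toℕ (y ⊖ x)
    size = ∸-monoˡ-≤ 1 (∣interval∣≤ x y)

  spread-over-progression : ∀ (A B : Subset p) (x : Fin p) m → m ≤ p →
    (∀ β → β ≤ m → (toℕ x + β) mod p ∈ B) → m ≤ ∣ A ∣ → 13 * ∣ A ∣ ≤ p →
    ∃[ b₁ ] ∃[ b₂ ] ∃[ b₃ ] b₁ ∈ B × b₂ ∈ B × b₃ ∈ B ×
      ∣ A ∣ + m ≤ ∣ A ⊞ (⁅ b₁ ⁆ ∪ ⁅ b₂ ⁆ ∪ ⁅ b₃ ⁆) ∣
  spread-over-progression A B x m m≤p x+β∈B m≤A 13A≤p
    with spread p m (χ A) (χ-periodic A) (subst (m ≤_) (∣∣≡∑χ A) m≤A)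
           (subst (λ k → 13 * k ≤ p) (∣∣≡∑χ A) 13A≤p)
  ... | i , j , k , i≤m , j≤m , k≤m , N+m≤ =
    b i , b j , b k , b∈ i , b∈ j , b∈ k , (begin
      ∣ A ∣ + m                          ≡⟨ cong (_+ m) (∣∣≡∑χ A) ⟩
      ∑[ n < p ] ⟦ χ A n ⟧ + m           ≤⟨ N+m≤ ⟩
      ∑ p h                              ≡⟨ ∑-periodicʳ h-periodic K ⟨
      ∑[ n < p ] h (n + K)               ≤⟨ ∑-mono p (λ n _ → covered n) ⟩
      ∑[ n < p ] ⟦ χ (A ⊞ T) n ⟧         ≡⟨ ∣∣≡∑χ (A ⊞ T) ⟨
      ∣ A ⊞ T ∣                          ∎)
    where
    open ≤-Reasoning
    b : ℕ → Fin p
    -- The order is reversed because A + (x + m - j) is A - j translated by x + m.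
    b j = (toℕ x + (m ∸ j)) mod p
    b∈ : ∀ j → b j ∈ B
    b∈ j = x+β∈B (m ∸ j) (m∸n≤m m j)
    T : Subset p
    T = ⁅ b i ⁆ ∪ ⁅ b j ⁆ ∪ ⁅ b k ⁆
    K : ℕ
    -- K represents -(x + m) modulo p, so `n + K + j` plus `b j` is n + 2p.
    K = (p ∸ toℕ x) + (p ∸ m)
    h : ℕ → ℕ
    h n = ⟦ (χ A (n + i) ∨ χ A (n + j)) ∨ χ A (n + k) ⟧
    h-periodic : Periodic p h
    h-periodic n rewrite +-assoc p n i | +-assoc p n j | +-assoc p n k
      | χ-periodic A (n + i) | χ-periodic A (n + j) | χ-periodic A (n + k) = refl
    translate : ∀ n j → j ≤ m → ((n + K + j) mod p) ⊕ b j ≡ n mod p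
    translate n j j≤m = trans (mod-⊕ (n + K + j) (toℕ x + (m ∸ j)) p)
      (trans (cong (_mod p) total) (trans (mod-periodic p (p + n)) (mod-periodic p n)))
      where
      lemma : ∀ n x x′ m′ j j′ → n + (x′ + m′) + j + (x + j′) ≡ x + x′ + (j + j′ + m′ + n)
      lemma = solve-∀
      total : n + K + j + (toℕ x + (m ∸ j)) ≡ p + (p + n)
      total = trans (lemma n (toℕ x) (p ∸ toℕ x) (p ∸ m) j (m ∸ j))
        (cong₂ (λ u v → u + (v + n)) (m+[n∸m]≡n (<⇒≤ (toℕ<n x)))
          (trans (cong (_+ (p ∸ m)) (m+[n∸m]≡n j≤m)) (m+[n∸m]≡n m≤p)))
    hit : ∀ n j → j ≤ m → b j ∈ T → χ A (n + K + j) ≡ true → χ (A ⊞ T) n ≡ true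
    hit n j j≤m bj∈T eq = []=⇒lookup (subst (_∈ A ⊞ T) (translate n j j≤m)
      (⊕∈⊞ (lookup⇒[]= _ A eq) bj∈T))
    ∨-bound : ∀ x y z {w} → (x ≡ true → w ≡ true) → (y ≡ true → w ≡ true) → (z ≡ true → w ≡ true) →
      ⟦ (x ∨ y) ∨ z ⟧ ≤ ⟦ w ⟧
    ∨-bound true  _     _     f g h rewrite f refl = ≤-refl
    ∨-bound false true  _     f g h rewrite g refl = ≤-refl
    ∨-bound false false true  f g h rewrite h refl = ≤-refl
    ∨-bound false false false f g h = z≤n
    covered : ∀ n → h (n + K) ≤ ⟦ χ (A ⊞ T) n ⟧
    covered n = ∨-bound (χ A (n + K + i)) _ _
      (hit n i i≤m (x∈p∪q⁺ (inj₁ (x∈⁅x⁆ (b i)))))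
      (hit n j j≤m (x∈p∪q⁺ (inj₂ (x∈p∪q⁺ (inj₁ (x∈⁅x⁆ (b j)))))))
      (hit n k k≤m (x∈p∪q⁺ (inj₂ (x∈p∪q⁺ (inj₂ (x∈⁅x⁆ (b k)))))))

-- The bound for subsets and the density constant

m+n∸1≤m+[n∸1] : ∀ m n → m + n ∸ 1 ≤ m + (n ∸ 1)
m+n∸1≤m+[n∸1] m zero    = m∸n≤m (m + 0) 1
m+n∸1≤m+[n∸1] m (suc n) = ≤-reflexive (cong (_∸ 1) (+-suc m n))

-- The density condition appears as 13 |A| ≤ p, the form that `slack-bound` calls for.
three-translates : ∀ {p} (A B : Subset p) → Nonempty A → ∣ B ∣ ≤ ∣ A ∣ → 13 * ∣ A ∣ ≤ p → IsInterval B →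
    ∃[ b₁ ] ∃[ b₂ ] ∃[ b₃ ] b₁ ∈ B × b₂ ∈ B × b₃ ∈ B ×
    ∣ A ⊞ (⁅ b₁ ⁆ ∪ ⁅ b₂ ⁆ ∪ ⁅ b₃ ⁆) ∣ ≥ ∣ A ∣ + ∣ B ∣ ∸ 1
three-translates {zero} A B (() , _)
three-translates {suc _} A B _ B≤A 13A≤p B-interval =
  let x , m≤p , x+β∈B = interval-progression B-interval
      b₁ , b₂ , b₃ , b₁∈ , b₂∈ , b₃∈ , bound = spread-over-progression A B x (∣ B ∣ ∸ 1) m≤p x+β∈B
        (≤-trans (m∸n≤m ∣ B ∣ 1) B≤A) 13A≤p
  in b₁ , b₂ , b₃ , b₁∈ , b₂∈ , b₃∈ , ≤-trans (m+n∸1≤m+[n∸1] ∣ A ∣ ∣ B ∣) bound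

shrink-factor : ∀ {k l a p} → k ≤ l → a * l ≤ p → k * a ≤ p
shrink-factor {k} {l} {a} k≤l al≤p =
  ≤-trans (≤-reflexive (*-comm k a)) (≤-trans (*-monoʳ-≤ a k≤l) al≤p)

13≤2²⁰ : 13 ≤ 2 ^ 20
13≤2²⁰ = ≤ᵇ⇒≤ 13 (2 ^ 20) tt

theorem6 : (p : ℕ) → Prime p → (A B : Subset p) → Nonempty A → Nonempty B →
    ∣ B ∣ ≤ ∣ A ∣ → ∣ A ∣ * 2 ^ 20 ≤ p → IsInterval B →
    ∃[ b₁ ] ∃[ b₂ ] ∃[ b₃ ] b₁ ∈ B × b₂ ∈ B × b₃ ∈ B ×
    ∣ A ⊞ (⁅ b₁ ⁆ ∪ ⁅ b₂ ⁆ ∪ ⁅ b₃ ⁆) ∣ ≥ ∣ A ∣ + ∣ B ∣ ∸ 1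
theorem6 p _ A B A≢∅ _ B≤A A*2²⁰≤p B-interval =
  three-translates A B A≢∅ B≤A (shrink-factor {13} {2 ^ 20} {∣ A ∣} 13≤2²⁰ A*2²⁰≤p) B-interval
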